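{- Let $G=(V,E,\Sigma,\lambda)$ be a labeled directed graph and let $\mathcal{G}=(N,\Sigma,P,S)$ be a context-free grammar in Chomsky normal form over the same alphabet $\Sigma$. Run the saturation algorithm SatIndex-Build (defined in the context) on $(G,\mathcal{G})$, and let $\{M_A\}_{A\in N}$ be the Boolean matrices at termination. Then for all $A\in N$ and all $u,v\in V$, \[ M_A[u,v]=1 \iff (u,v)\in\mathcal{R}_A . \]
   Context: A labeled directed graph is $G=(V,E,\Sigma,\lambda)$ with $V$ a finite set of vertices, $E\subseteq V\times V$ the directed edges, $\Sigma$ a finite alphabet, and $\lambda:E\to\Sigma$ a labeling of the edges. A path $\pi$ from $v_0$ to $v_k$ is a (possibly empty) sequence of edges $(v_0,v_1)\cdots(v_{k-1},v_k)$; the empty path at $u$ goes from $u$ to $u$. The trace is $\operatorname{tr}(\pi)=\lambda(v_0,v_1)\cdots\lambda(v_{k-1},v_k)\in\Sigma^*$. A context-free grammar is $\mathcal{G}=(N,\Sigma,P,S)$ with finite nonterminal set $N$, terminals $\Sigma$, productions $P$, start symbol $S\in N$; $\mathcal{L}_{\mathcal{G}}(A)\subseteq\Sigma^*$ is the language generated from $A\in N$. It is in Chomsky normal form (CNF) here if each production is $A\to BC$, $A\to a$, or (optionally) $S\to\varepsilon$, with $A,B,C\in N$, $a\in\Sigma$. For $A\in N$, $\mathcal{R}_A\subseteq V\times V$ is defined by $(u,v)\in\mathcal{R}_A$ iff there is a path $\pi$ from $u$ to $v$ with $\operatorname{tr}(\pi)\in\mathcal{L}_{\mathcal{G}}(A)$.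 Algorithm SatIndex-Build$(G,\mathcal{G})$. Maintain matrices $M_A\in\{0,1\}^{V\times V}$ for $A\in N$ (initially all $0$), a witness table $W[A,u,v]$ (initially all undefined), and a queue $Q$ (initially empty). "Insert $(A,u,v)$ with record $w$" means: if $M_A[u,v]=0$, set $M_A[u,v]\gets 1$, $W[A,u,v]\gets w$, and enqueue $(A,u,v)$; otherwise do nothing. (1) For each production $A\to a$ in $P$ and each edge $(u,v)\in E$ with $\lambda(u,v)=a$, insert $(A,u,v)$ with record $\langle\mathsf{term},(u,v)\rangle$. (2) If $S\to\varepsilon\in P$, for each $u\in V$ insert $(S,u,u)$ with record $\langle\mathsf{eps}\rangle$. (3) While $Q$ is nonempty: dequeue some $(X,i,j)$. For each production $A\to BC$ in $P$: if $X=B$, then for every $k\in V$ with $M_C[j,k]=1$ insert $(A,i,k)$ with record $\langle\mathsf{bin},B,C,j\rangle$; and if $X=C$, then for every $h\in V$ with $M_B[h,i]=1$ insert $(A,h,j)$ with record $\langle\mathsf{bin},B,C,i\rangle$. Return $\{M_A\}$ and $W$. -}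

module Defs where

open import Data.Bool using (Bool; true; false; T; if_then_else_)
open import Data.Bool.Properties using (T?)
open import Data.Fin using (Fin)
import Data.Fin as Fin
open import Data.List using (List; []; _∷_; _++_; map; foldl; length; allFin; cartesianProduct)
open import Data.List.Properties using (≡-dec; length-++)
open import Data.List.Membership.Propositional using (_∈_)
open import Data.List.Membership.Propositional.Properties using (∈-cartesianProduct⁺; ∈-allFin)
open import Data.List.Relation.Unary.All using (All)
open import Data.List.Relation.Unary.Any using (here; there)
import Data.List.Membership.DecPropositional as DecMembership
open import Data.Maybe using (Maybe; just; nothing)
open import Data.Nat using (ℕ; suc; _+_; _≤_; _<_; z≤n; s≤s)
open import Data.Nat.Properties
  using (≤-refl; ≤-trans; ≤-reflexive; m≤n⇒m≤1+n; +-monoˡ-≤; +-suc; +-comm; module ≤-Reasoning)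
open import Data.Nat.Induction using (<-wellFounded)
open import Data.Product using (Σ-syntax; ∃-syntax; _×_; _,_)
import Data.Product.Properties as Product
open import Data.Sum using (_⊎_; inj₁; inj₂)
import Data.Sum.Properties as Sum
open import Function using (id; flip)
open import Induction.WellFounded using (WellFounded; Acc; acc; module Subrelation)
open import Relation.Binary.Construct.Closure.ReflexiveTransitive using (Star; ε; _◅_)
import Relation.Binary.Construct.On as On
open import Relation.Binary.Definitions using (DecidableEquality)
open import Relation.Binary.PropositionalEquality using (_≡_; refl; sym; trans; cong)
open import Relation.Nullary using (yes; no; does)

------------------------------------------------------------------------
-- Labeled directed graphs over the alphabet Fin σ

record LabeledDigraph (σ : ℕ) : Set where
  field
    order : ℕ

  V : Set
  V = Fin order

  field
    isEdge : V → V → Bool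

  Edge : V → V → Set
  Edge u v = T (isEdge u v)

  field
    label : ∀ u v → Edge u v → Fin σ

  Path : V → V → Set
  Path = Star Edge

  tr : ∀ {u v} → Path u v → List (Fin σ)
  tr ε                         = []
  tr (_◅_ {i = u} {j = v} e π) = label u v e ∷ tr π

------------------------------------------------------------------------
-- Context-free grammars over the alphabet Fin σ

record CFG (σ : ℕ) : Set where
  field
    #nonterminals : ℕ

  N : Set
  N = Fin #nonterminals

  Symbol : Set
  Symbol = N ⊎ Fin σ

  Production : Set
  Production = N × List Symbol

  field
    P : List Production
    S : N

  infix 4 _⇒_ _⇒*_ _≟ₚ_

  data _⇒_ : List Symbol → List Symbol → Set where
    rewriteAt : ∀ α β {A γ} → (A , γ) ∈ P → α ++ inj₁ A ∷ β ⇒ α ++ γ ++ β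

  _⇒*_ : List Symbol → List Symbol → Set
  _⇒*_ = Star _⇒_

  𝓛 : N → List (Fin σ) → Set
  𝓛 A w = inj₁ A ∷ [] ⇒* map inj₂ w

  -- The start symbol may occur on right-hand sides even if S → ε is present.
  data CNFProduction : Production → Set where
    binary   : ∀ {A B C} → CNFProduction (A , inj₁ B ∷ inj₁ C ∷ [])
    terminal : ∀ {A a}   → CNFProduction (A , inj₂ a ∷ [])
    empty    : CNFProduction (S , [])

  CNF : Set
  CNF = All CNFProduction P

  _≟ₚ_ : DecidableEquality Production
  _≟ₚ_ = Product.≡-dec Fin._≟_ (≡-dec (Sum.≡-dec Fin._≟_ Fin._≟_))

module _ {σ : ℕ} (G : LabeledDigraph σ) (𝒢 : CFG σ) where
  open LabeledDigraph G
  open CFG 𝒢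

  𝓡 : N → V → V → Set
  𝓡 A u v = Σ[ π ∈ Path u v ] 𝓛 A (tr π)

------------------------------------------------------------------------
-- The algorithm

module SatIndexBuild {σ : ℕ} (G : LabeledDigraph σ) (𝒢 : CFG σ) where
  open LabeledDigraph G
  open CFG 𝒢
  open DecMembership _≟ₚ_ using (_∈?_)

  Triple : Set
  Triple = N × V × V

  _≟ₜ_ : DecidableEquality Triple
  _≟ₜ_ = Product.≡-dec Fin._≟_ (Product.≡-dec Fin._≟_ Fin._≟_)

  data Record : Set where
    term : V → V → Record
    eps  : Record
    bin  : N → N → V → Record

  record State : Set where
    constructor ⟨_,_,_⟩
    field
      M : N → V → V → Bool
      W : N → V → V → Maybe Record
      Q : List Triple

  open State public

  _[_≔_] : {X : Set} → (N → V → V → X) → Triple → X → N → V → V → X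
  (f [ t ≔ x ]) A u v = if does (t ≟ₜ (A , u , v)) then x else f A u v

  insert : Triple → Record → State → State
  insert t@(A , u , v) w s =
    if M s A u v then s
    else ⟨ M s [ t ≔ true ] , W s [ t ≔ just w ] , Q s ++ t ∷ [] ⟩

  -- Each iteration sees the state left by the previous one; in particular,
  -- the tests on M below read its current value, not a snapshot.
  forEach : {X : Set} → List X → (X → State → State) → State → State
  forEach xs body s = foldl (λ s x → body x s) s xs

  initial : State
  initial = ⟨ (λ _ _ _ → false) , (λ _ _ _ → nothing) , [] ⟩

  insertIfLabeled : N → Fin σ → V → V → State → State
  insertIfLabeled A a u v with T? (isEdge u v)
  ... | no  _ = id
  ... | yes e = if does (label u v e Fin.≟ a) then insert (A , u , v) (term u v) else id

  terminalBody : Production → State → State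
  terminalBody (A , inj₂ a ∷ []) =
    forEach (cartesianProduct (allFin order) (allFin order)) λ (u , v) →
      insertIfLabeled A a u v
  terminalBody _ = id

  terminalPhase : State → State
  terminalPhase = forEach P terminalBody

  epsilonPhase : State → State
  epsilonPhase =
    if does ((S , []) ∈? P) then forEach (allFin order) (λ u → insert (S , u , u) eps)
    else id

  leftJoin : Triple → N → N → N → State → State
  leftJoin (X , i , j) A B C =
    if does (X Fin.≟ B)
    then forEach (allFin order) (λ k s →
           if M s C j k then insert (A , i , k) (bin B C j) s else s)
    else id

  rightJoin : Triple → N → N → N → State → State
  rightJoin (X , i , j) A B C =
    if does (X Fin.≟ C)
    then forEach (allFin order) (λ h s →
           if M s B h i then insert (A , h , j) (bin B C i) s else s)
    else id

  processBody : Triple → Production → State → State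
  processBody t (A , inj₁ B ∷ inj₁ C ∷ []) s = rightJoin t A B C (leftJoin t A B C s)
  processBody t _ s = s

  process : Triple → State → State
  process t = forEach P (processBody t)

  -- One iteration of the while loop; any element of the queue may be dequeued.
  infix 4 _⟶_ _⟶*_

  data _⟶_ : State → State → Set where
    dequeue : ∀ {M W} ts t ts′ →
              ⟨ M , W , ts ++ t ∷ ts′ ⟩ ⟶ process t ⟨ M , W , ts ++ ts′ ⟩

  _⟶*_ : State → State → Set
  _⟶*_ = Star _⟶_

  -- s is a possible state at termination.
  Final : State → Set
  Final s = epsilonPhase (terminalPhase initial) ⟶* s × Q s ≡ []

------------------------------------------------------------------------
-- Every run is finite, whatever the dequeuing order, and so some final state
-- exists.  An insertion turns one 0 of M into a 1 and adds one queue element,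
-- so the number of 0s plus the queue length never grows within an iteration
-- and each dequeuing lowers it.

module Termination {σ : ℕ} (G : LabeledDigraph σ) (𝒢 : CFG σ) where
  open LabeledDigraph G
  open CFG 𝒢
  open SatIndexBuild G 𝒢

  triples : List Triple
  triples = cartesianProduct (allFin #nonterminals)
              (cartesianProduct (allFin order) (allFin order))

  ∈-triples : ∀ t → t ∈ triples
  ∈-triples (A , u , v) =
    ∈-cartesianProduct⁺ (∈-allFin A) (∈-cartesianProduct⁺ (∈-allFin u) (∈-allFin v))

  Matrix : Set
  Matrix = N → V → V → Bool

  zerosIn : List Triple → Matrix → ℕ
  zerosIn []                 m = 0
  zerosIn ((A , u , v) ∷ ts) m = if m A u v then zerosIn ts m else suc (zerosIn ts m)

  zerosIn-set-≤ : ∀ ts t m → zerosIn ts (m [ t ≔ true ]) ≤ zerosIn ts m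
  zerosIn-set-≤ [] t m = z≤n
  zerosIn-set-≤ ((A , u , v) ∷ ts) t m with does (t ≟ₜ (A , u , v)) | m A u v
  ... | true  | true  = zerosIn-set-≤ ts t m
  ... | true  | false = m≤n⇒m≤1+n (zerosIn-set-≤ ts t m)
  ... | false | true  = zerosIn-set-≤ ts t m
  ... | false | false = s≤s (zerosIn-set-≤ ts t m)

  zerosIn-set-< : ∀ {ts A u v} m → (A , u , v) ∈ ts → m A u v ≡ false →
                  zerosIn ts (m [ (A , u , v) ≔ true ]) < zerosIn ts m
  zerosIn-set-< {_ ∷ ts} {A} {u} {v} m (here refl) eq
    with (A , u , v) ≟ₜ (A , u , v)
  ... | no ≢ with () ← ≢ refl
  ... | yes _ rewrite eq = s≤s (zerosIn-set-≤ ts (A , u , v) m)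
  zerosIn-set-< {(B , x , y) ∷ ts} {A} {u} {v} m (there t∈) eq
    with does ((A , u , v) ≟ₜ (B , x , y)) | m B x y
  ... | true  | true  = zerosIn-set-< m t∈ eq
  ... | true  | false = m≤n⇒m≤1+n (zerosIn-set-< m t∈ eq)
  ... | false | true  = zerosIn-set-< m t∈ eq
  ... | false | false = s≤s (zerosIn-set-< m t∈ eq)

  cost : State → ℕ
  cost s = zerosIn triples (M s) + length (Q s)

  NonIncreasing : (State → State) → Set
  NonIncreasing f = ∀ s → cost (f s) ≤ cost s

  insert-cost : ∀ t w → NonIncreasing (insert t w)
  insert-cost t@(A , u , v) w s with M s A u v in eq
  ... | true  = ≤-refl
  ... | false = begin
    z′ + length (Q s ++ t ∷ []) ≡⟨ cong (z′ +_) (trans (length-++ (Q s)) (+-comm _ 1)) ⟩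
    z′ + suc (length (Q s))     ≡⟨ +-suc z′ _ ⟩
    suc z′ + length (Q s)       ≤⟨ +-monoˡ-≤ _ (zerosIn-set-< (M s) (∈-triples t) eq) ⟩
    cost s                      ∎
    where
    open ≤-Reasoning
    z′ = zerosIn triples (M s [ t ≔ true ])

  forEach-cost : ∀ {X : Set} (xs : List X) {body} → (∀ x → NonIncreasing (body x)) →
                 NonIncreasing (forEach xs body)
  forEach-cost []       h s = ≤-refl
  forEach-cost (x ∷ xs) h s = ≤-trans (forEach-cost xs h _) (h x s)

  leftJoin-cost : ∀ t A B C → NonIncreasing (leftJoin t A B C)
  leftJoin-cost (X , i , j) A B C s with does (X Fin.≟ B)
  ... | false = ≤-refl
  ... | true  = forEach-cost (allFin order) step s
    where
    step : ∀ k → NonIncreasing (λ s → if M s C j k then insert (A , i , k) (bin B C j) s else s)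
    step k s with M s C j k
    ... | true  = insert-cost (A , i , k) (bin B C j) s
    ... | false = ≤-refl

  rightJoin-cost : ∀ t A B C → NonIncreasing (rightJoin t A B C)
  rightJoin-cost (X , i , j) A B C s with does (X Fin.≟ C)
  ... | false = ≤-refl
  ... | true  = forEach-cost (allFin order) step s
    where
    step : ∀ h → NonIncreasing (λ s → if M s B h i then insert (A , h , j) (bin B C i) s else s)
    step h s with M s B h i
    ... | true  = insert-cost (A , h , j) (bin B C i) s
    ... | false = ≤-refl

  processBody-cost : ∀ t p → NonIncreasing (processBody t p)
  processBody-cost t (A , inj₁ B ∷ inj₁ C ∷ []) s =
    ≤-trans (rightJoin-cost t A B C _) (leftJoin-cost t A B C s)
  processBody-cost t (A , [])                       s = ≤-refl
  processBody-cost t (A , inj₂ _ ∷ _)               s = ≤-refl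
  processBody-cost t (A , inj₁ _ ∷ [])              s = ≤-refl
  processBody-cost t (A , inj₁ _ ∷ inj₂ _ ∷ _)      s = ≤-refl
  processBody-cost t (A , inj₁ _ ∷ inj₁ _ ∷ _ ∷ _)  s = ≤-refl

  ⟶-cost : ∀ {s s′} → s ⟶ s′ → cost s′ < cost s
  ⟶-cost (dequeue {m} {w} ts t ts′) = begin-strict
    cost (process t ⟨ m , w , ts ++ ts′ ⟩) ≤⟨ forEach-cost P (processBody-cost t) _ ⟩
    z + length (ts ++ ts′)                 <⟨ ≤-refl ⟩
    suc (z + length (ts ++ ts′))           ≡⟨ +-suc z _ ⟨
    z + suc (length (ts ++ ts′))           ≡⟨ cong (z +_) lengths ⟨
    z + length (ts ++ t ∷ ts′)             ∎
    where
    open ≤-Reasoning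
    z = zerosIn triples m
    lengths : length (ts ++ t ∷ ts′) ≡ suc (length (ts ++ ts′))
    lengths = trans (length-++ ts)
                (trans (+-suc (length ts) _) (cong suc (sym (length-++ ts))))

  ⟶-wellFounded : WellFounded (flip _⟶_)
  ⟶-wellFounded = Subrelation.wellFounded ⟶-cost (On.wellFounded cost <-wellFounded)

  runFrom : ∀ s → Acc (flip _⟶_) s → ∃[ s′ ] (s ⟶* s′ × Q s′ ≡ [])
  runFrom s@(⟨ _ , _ , [] ⟩) _ = s , ε , refl
  runFrom ⟨ _ , _ , t ∷ ts ⟩ (acc rec) with step ← dequeue [] t ts
    with s′ , steps , done ← runFrom _ (rec step) = s′ , step ◅ steps , done

  terminates : ∃[ s ] Final s
  terminates = runFrom _ (⟶-wellFounded _)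

{-# OPTIONS --safe #-}

-- Reading a production A → γ as "a chain of relations spelled by γ composes into A" gives the
-- inductively defined relation Reach A u v, which coincides with 𝓡.  Soundness: everything that
-- is marked or queued is in Reach.  Completeness: if B(i,j) and C(j,k) are marked and A → BC, then
-- A(i,k) is marked or one of the two premises is still queued, so at termination the marks
-- are closed under the rules defining Reach.  The invariant survives reads of a changing
-- matrix because every mark set during an iteration of the main loop is queued, and stays
-- queued until that iteration ends.
module Submission where

open import Defs
open import Data.Bool using (true; false; if_then_else_)
open import Data.Bool.Properties using (T?; T-irrelevant)
import Data.Fin as Fin
open import Data.List using (List; []; _∷_; _++_; map; allFin; cartesianProduct)
open import Data.List.Properties using (++-assoc; map-++)
open import Data.List.Membership.Propositional using (_∈_)
open import Data.List.Membership.Propositional.Properties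
  using (∈-cartesianProduct⁺; ∈-allFin; ∈-++⁺ˡ; ∈-++⁺ʳ; ∈-++⁻)
import Data.List.Membership.DecPropositional as DecMembership
open import Data.List.Relation.Binary.Subset.Propositional using (_⊆_)
open import Data.List.Relation.Unary.All as All using (All; []; _∷_)
import Data.List.Relation.Unary.All.Properties as All
open import Data.List.Relation.Unary.Any using (here; there)
open import Data.Maybe using (just)
open import Data.Nat using (ℕ)
open import Data.Product using (∃-syntax; _×_; _,_; proj₁)
open import Data.Sum as Sum using (_⊎_; inj₁; inj₂)
open import Function using (_∘_; id)
open import Function.Bundles using (_⇔_; mk⇔)
open import Relation.Binary.Construct.Closure.ReflexiveTransitive using (ε; _◅_; _◅◅_; gmap)
open import Relation.Binary.PropositionalEquality using (_≡_; refl; sym; trans; cong; subst; subst₂)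
open import Relation.Nullary using (yes; no; contradiction)

-- Derivations and traces under concatenation

module _ {σ : ℕ} (𝒢 : CFG σ) where
  open CFG 𝒢

  ⇒-++ˡ : ∀ α {β γ} → β ⇒ γ → α ++ β ⇒ α ++ γ
  ⇒-++ˡ α (rewriteAt β γ p) =
    subst₂ _⇒_ (++-assoc α β _) (++-assoc α β _) (rewriteAt (α ++ β) γ p)

  ⇒-++ʳ : ∀ α {β γ} → β ⇒ γ → β ++ α ⇒ γ ++ α
  ⇒-++ʳ α (rewriteAt β γ {A} {δ} p) =
    subst₂ _⇒_ (sym (++-assoc β (inj₁ A ∷ γ) α))
      (sym (trans (++-assoc β (δ ++ γ) α) (cong (β ++_) (++-assoc δ γ α))))
      (rewriteAt β (γ ++ α) p)

  -- The left part is rewritten first with `β` as an idle right context, then the right part behind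
  -- the finished `α′`.
  ⇒*-++ : ∀ {α α′ β β′} → α ⇒* α′ → β ⇒* β′ → α ++ β ⇒* α′ ++ β′
  ⇒*-++ {α′ = α′} {β = β} d e = gmap (_++ β) (⇒-++ʳ β) d ◅◅ gmap (α′ ++_) (⇒-++ˡ α′) e

module _ {σ : ℕ} (G : LabeledDigraph σ) where
  open LabeledDigraph G

  tr-◅◅ : ∀ {u v w} (π : Path u v) (ρ : Path v w) → tr (π ◅◅ ρ) ≡ tr π ++ tr ρ
  tr-◅◅ ε       ρ = refl
  tr-◅◅ (e ◅ π) ρ = cong (_ ∷_) (tr-◅◅ π ρ)

-- Inductive reachability and its agreement with `𝓡`

module Reachability {σ : ℕ} (G : LabeledDigraph σ) (𝒢 : CFG σ) where
  open LabeledDigraph G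
  open CFG 𝒢

  data Reach : N → V → V → Set where
    term : ∀ {A a u v} → (A , inj₂ a ∷ []) ∈ P → (e : Edge u v) → label u v e ≡ a → Reach A u v
    eps  : ∀ {u} → (S , []) ∈ P → Reach S u u
    bin  : ∀ {A B C i j k} → (A , inj₁ B ∷ inj₁ C ∷ []) ∈ P →
           Reach B i j → Reach C j k → Reach A i k

  Reach⇒𝓡 : ∀ {A u v} → Reach A u v → 𝓡 G 𝒢 A u v
  Reach⇒𝓡 (term p e refl) = e ◅ ε , rewriteAt [] [] p ◅ ε
  Reach⇒𝓡 (eps p)         = ε , rewriteAt [] [] p ◅ ε
  Reach⇒𝓡 {A} (bin p r s) with π , d ← Reach⇒𝓡 r | ρ , e ← Reach⇒𝓡 s =
    π ◅◅ ρ ,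
    subst (inj₁ A ∷ [] ⇒*_)
      (trans (sym (map-++ inj₂ (tr π) (tr ρ))) (cong (map inj₂) (sym (tr-◅◅ G π ρ))))
      (rewriteAt [] [] p ◅ ⇒*-++ 𝒢 d e)

  -- A sentential form read as a walk: a terminal crosses an edge with that label, a nonterminal
  -- jumps along `Reach`. This applies to every intermediate form of a derivation, not only to
  -- terminal words.
  data Spells : List Symbol → V → V → Set where
    []  : ∀ {u} → Spells [] u u
    nt  : ∀ {A α u v w} → Reach A u v → Spells α v w → Spells (inj₁ A ∷ α) u w
    tm  : ∀ {a α u v w} (e : Edge u v) → label u v e ≡ a → Spells α v w → Spells (inj₂ a ∷ α) u w

  Spells-tr : ∀ {u v} (π : Path u v) → Spells (map inj₂ (tr π)) u v
  Spells-tr ε       = []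
  Spells-tr (e ◅ π) = tm e refl (Spells-tr π)

  module _ (cnf : CNF) where

    -- Once the prefix `α` is peeled off, the form begins with `γ`. The three CNF shapes of `γ`
    -- match the three constructors of `Reach`, each of which folds the walk along `γ` into one jump
    -- along `A`.
    Spells-rewrite : ∀ α {A β γ u v} → (A , γ) ∈ P →
                     Spells (α ++ γ ++ β) u v → Spells (α ++ inj₁ A ∷ β) u v
    Spells-rewrite (_ ∷ α) p (nt r x)   = nt r (Spells-rewrite α p x)
    Spells-rewrite (_ ∷ α) p (tm e l x) = tm e l (Spells-rewrite α p x)
    Spells-rewrite [] p x with All.lookup cnf p | x
    ... | binary   | nt r (nt s y) = nt (bin p r s) y
    ... | terminal | tm e l y      = nt (term p e l) y
    ... | empty    | y             = nt (eps p) y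

    -- Folding rewrites backwards from the last form means that a derivation from `B C` never has to
    -- be split into one from `B` and one from `C`.
    Spells-⇒* : ∀ {α β u v} → α ⇒* β → Spells β u v → Spells α u v
    Spells-⇒* ε                     x = x
    Spells-⇒* (rewriteAt α _ p ◅ d) x = Spells-rewrite α p (Spells-⇒* d x)

    𝓡⇒Reach : ∀ {A u v} → 𝓡 G 𝒢 A u v → Reach A u v
    𝓡⇒Reach (π , d) with nt r [] ← Spells-⇒* d (Spells-tr π) = r

-- Invariants of the saturation algorithm

module Correctness {σ : ℕ} (G : LabeledDigraph σ) (𝒢 : CFG σ) (cnf : CFG.CNF 𝒢) where
  open LabeledDigraph G
  open CFG 𝒢
  open SatIndexBuild G 𝒢
  open Reachability G 𝒢
  open DecMembership _≟ₚ_ using (_∈?_)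

  Marked : State → Triple → Set
  Marked s (A , u , v) = M s A u v ≡ true

  ReachT : Triple → Set
  ReachT (A , u , v) = Reach A u v

  -- The hypothesis on the body receives `x ∈ xs` because loops over `P` need to know that the
  -- current production belongs to the grammar.
  forEach-preserves : ∀ {X : Set} (I : State → Set) {xs : List X} {body} →
                      (∀ {x} → x ∈ xs → ∀ {s} → I s → I (body x s)) →
                      ∀ {s} → I s → I (forEach xs body s)
  forEach-preserves I {[]}     h i = i
  forEach-preserves I {x ∷ xs} h i = forEach-preserves I (h ∘ there) (h (here refl) i)

  vertexPairs : List (V × V)
  vertexPairs = cartesianProduct (allFin order) (allFin order)

  -- Soundness

  -- The queue is included because a dequeued triple serves as a premise of the joins without being
  -- looked up in `M`.
  Sound : State → Set
  Sound s = (∀ t → Marked s t → ReachT t) × All ReachT (Q s)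

  insert-sound : ∀ t w → ReachT t → ∀ {s} → Sound s → Sound (insert t w s)
  insert-sound t@(A , u , v) w r {s} (m , q) with M s A u v
  ... | true  = m , q
  ... | false = marks , All.++⁺ q (r ∷ [])
    where
    marks : ∀ t′ → Marked (⟨ M s [ t ≔ true ] , W s [ t ≔ just w ] , Q s ++ t ∷ [] ⟩) t′ → ReachT t′
    marks t′ with t ≟ₜ t′
    ... | yes refl = λ _ → r
    ... | no  _    = m t′

  insertIfLabeled-sound : ∀ {A a} → (A , inj₂ a ∷ []) ∈ P → ∀ u v {s} →
                          Sound s → Sound (insertIfLabeled A a u v s)
  insertIfLabeled-sound {A} {a} p u v i with T? (isEdge u v)
  ... | no  _ = i
  ... | yes e with label u v e Fin.≟ a
  ...   | no  _ = i
  ...   | yes l = insert-sound (A , u , v) _ (term p e l) i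

  terminalBody-sound : ∀ {p} → p ∈ P → ∀ {s} → Sound s → Sound (terminalBody p s)
  terminalBody-sound p i with All.lookup cnf p
  ... | binary   = i
  ... | terminal =
    forEach-preserves Sound {vertexPairs} (λ {(u , v)} _ → insertIfLabeled-sound p u v) i
  ... | empty    = i

  epsilonPhase-sound : ∀ {s} → Sound s → Sound (epsilonPhase s)
  epsilonPhase-sound i with (S , []) ∈? P
  ... | no  _ = i
  ... | yes p =
    forEach-preserves Sound {allFin order} (λ {u} _ → insert-sound (S , u , u) eps (eps p)) i

  leftJoin-sound : ∀ {A B C} t → (A , inj₁ B ∷ inj₁ C ∷ []) ∈ P → ReachT t → ∀ {s} →
                   Sound s → Sound (leftJoin t A B C s)
  leftJoin-sound {A} {B} {C} (X , i , j) p r inv with X Fin.≟ B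
  ... | no  _    = inv
  ... | yes refl = forEach-preserves Sound {allFin order} (λ {k} _ → step k) inv
    where
    step : ∀ k {s} → Sound s → Sound (if M s C j k then insert (A , i , k) (bin B C j) s else s)
    step k {s} inv with M s C j k in eq
    -- The test reads the current matrix, so soundness of the current state supplies the second
    -- premise.
    ... | true  = insert-sound (A , i , k) _ (bin p r (proj₁ inv _ eq)) inv
    ... | false = inv

  rightJoin-sound : ∀ {A B C} t → (A , inj₁ B ∷ inj₁ C ∷ []) ∈ P → ReachT t → ∀ {s} →
                    Sound s → Sound (rightJoin t A B C s)
  rightJoin-sound {A} {B} {C} (X , i , j) p r inv with X Fin.≟ C
  ... | no  _    = inv
  ... | yes refl = forEach-preserves Sound {allFin order} (λ {h} _ → step h) inv
    where
    step : ∀ h {s} → Sound s → Sound (if M s B h i then insert (A , h , j) (bin B C i) s else s)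
    step h {s} inv with M s B h i in eq
    ... | true  = insert-sound (A , h , j) _ (bin p (proj₁ inv _ eq) r) inv
    ... | false = inv

  processBody-sound : ∀ {t p} → ReachT t → p ∈ P → ∀ {s} → Sound s → Sound (processBody t p s)
  processBody-sound {t} r p i with All.lookup cnf p
  ... | binary   = rightJoin-sound t p r (leftJoin-sound t p r i)
  ... | terminal = i
  ... | empty    = i

  ⟶*-sound : ∀ {s s′} → s ⟶* s′ → Sound s → Sound s′
  ⟶*-sound ε inv = inv
  ⟶*-sound (dequeue ts t ts′ ◅ steps) (m , q) with qˡ , r ∷ qʳ ← All.++⁻ ts q =
    ⟶*-sound steps
      (forEach-preserves Sound {P} (processBody-sound r) (m , All.++⁺ qˡ qʳ))

  final-sound : ∀ {s} → Final s → Sound s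
  final-sound (steps , _) =
    ⟶*-sound steps
      (epsilonPhase-sound (forEach-preserves Sound {P} terminalBody-sound ((λ _ ()) , [])))

  -- Completeness

  infix 4 _⊑_

  -- Growth by insertions alone: by `fresh`, no mark appears without its triple being queued.
  -- Dequeuing shrinks the queue, so states are compared only within initialization or within the
  -- processing of one dequeued triple.
  record _⊑_ (s s′ : State) : Set where
    field
      marked : ∀ t → Marked s t → Marked s′ t
      queued : Q s ⊆ Q s′
      fresh  : ∀ t → Marked s′ t → Marked s t ⊎ t ∈ Q s′

  open _⊑_

  ⊑-refl : ∀ {s} → s ⊑ s
  ⊑-refl = record { marked = λ _ → id ; queued = id ; fresh = λ _ → inj₁ }

  ⊑-trans : ∀ {s s′ s″} → s ⊑ s′ → s′ ⊑ s″ → s ⊑ s″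
  ⊑-trans p q = record
    { marked = λ t → marked q t ∘ marked p t
    ; queued = queued q ∘ queued p
    ; fresh  = λ t → Sum.[ Sum.map₂ (queued q) ∘ fresh p t , inj₂ ]′ ∘ fresh q t
    }

  Extensive : (State → State) → Set
  Extensive f = ∀ {s} → s ⊑ f s

  insert-⊑ : ∀ t w → Extensive (insert t w)
  insert-⊑ t@(A , u , v) w {s} with M s A u v
  ... | true  = ⊑-refl
  ... | false = record { marked = marked′ ; queued = ∈-++⁺ˡ ; fresh = fresh′ }
    where
    s′ = ⟨ M s [ t ≔ true ] , W s [ t ≔ just w ] , Q s ++ t ∷ [] ⟩
    marked′ : ∀ t′ → Marked s t′ → Marked s′ t′
    marked′ t′ m with t ≟ₜ t′
    ... | yes _ = refl
    ... | no  _ = m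
    fresh′ : ∀ t′ → Marked s′ t′ → Marked s t′ ⊎ t′ ∈ Q s′
    fresh′ t′ m with t ≟ₜ t′
    ... | yes refl = inj₂ (∈-++⁺ʳ (Q s) (here refl))
    ... | no  _    = inj₁ m

  insert-marks : ∀ t w s → Marked (insert t w s) t
  insert-marks t@(A , u , v) w s with M s A u v in eq
  ... | true  = eq
  ... | false with t ≟ₜ t
  ...   | yes _ = refl
  ...   | no ≢  = contradiction refl ≢

  forEach-⊑ : ∀ {X : Set} {xs : List X} {body} →
              (∀ {x} → x ∈ xs → Extensive (body x)) → Extensive (forEach xs body)
  forEach-⊑ h {s} = forEach-preserves (s ⊑_) (λ x∈ i → ⊑-trans i (h x∈)) ⊑-refl

  -- The witness is the state in which `x` has its turn; all later turns only extend what its body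
  -- leaves behind.
  forEach-visits : ∀ {X : Set} {xs : List X} {body} →
                   (∀ {x} → x ∈ xs → Extensive (body x)) →
                   ∀ {x} → x ∈ xs → ∀ s → ∃[ s′ ] body x s′ ⊑ forEach xs body s
  forEach-visits h (here refl) s = s , forEach-⊑ (h ∘ there)
  forEach-visits h (there x∈)  s = forEach-visits (h ∘ there) x∈ _

  insertIfLabeled-⊑ : ∀ A a u v → Extensive (insertIfLabeled A a u v)
  insertIfLabeled-⊑ A a u v with T? (isEdge u v)
  ... | no  _ = ⊑-refl
  ... | yes e with label u v e Fin.≟ a
  ...   | no  _ = ⊑-refl
  ...   | yes _ = insert-⊑ (A , u , v) _

  insertIfLabeled-marks : ∀ A u v e s → Marked (insertIfLabeled A (label u v e) u v s) (A , u , v)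
  insertIfLabeled-marks A u v e s with T? (isEdge u v)
  ... | no ¬e = contradiction e ¬e
  ... | yes e′ with label u v e′ Fin.≟ label u v e
  ...   | yes _ = insert-marks (A , u , v) _ s
  -- The edge proof `e′` found by the test need not be the given `e`, but proofs of `T` are unique,
  -- so the two labels agree.
  ...   | no ≢  = contradiction (cong (label u v) (T-irrelevant e′ e)) ≢

  terminalBody-⊑ : ∀ {p} → p ∈ P → Extensive (terminalBody p)
  terminalBody-⊑ p with All.lookup cnf p
  ... | binary           = ⊑-refl
  ... | terminal {A} {a} = forEach-⊑ {xs = vertexPairs} λ {(u , v)} _ → insertIfLabeled-⊑ A a u v
  ... | empty            = ⊑-refl

  -- Two visits are combined, one in the outer loop over `P` and one in the inner loop over vertex
  -- pairs; the mark set there is never erased.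
  terminalPhase-marks : ∀ {A u v} e → (A , inj₂ (label u v e) ∷ []) ∈ P → ∀ s →
                        Marked (terminalPhase s) (A , u , v)
  terminalPhase-marks {A} {u} {v} e p s
    with s₁ , le₁ ← forEach-visits terminalBody-⊑ p s
    with s₂ , le₂ ← forEach-visits {xs = vertexPairs}
                      (λ {(x , y)} _ → insertIfLabeled-⊑ A (label u v e) x y)
                      (∈-cartesianProduct⁺ (∈-allFin u) (∈-allFin v)) s₁
    = marked le₁ _ (marked le₂ _ (insertIfLabeled-marks A u v e s₂))

  epsilonPhase-⊑ : Extensive epsilonPhase
  epsilonPhase-⊑ with (S , []) ∈? P
  ... | no  _ = ⊑-refl
  ... | yes _ = forEach-⊑ {xs = allFin order} λ {u} _ → insert-⊑ (S , u , u) _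

  epsilonPhase-marks : (S , []) ∈ P → ∀ u s → Marked (epsilonPhase s) (S , u , u)
  epsilonPhase-marks p u s with (S , []) ∈? P
  ... | no ∉  = contradiction p ∉
  ... | yes _ with s₁ , le ← forEach-visits {xs = allFin order} {λ x → insert (S , x , x) eps}
                               (λ {x} _ → insert-⊑ (S , x , x) eps) (∈-allFin u) s
    = marked le _ (insert-marks (S , u , u) eps s₁)

  -- The loop body common to both joins: the tested triple is the partner of the dequeued one, and
  -- `t` is the conclusion.
  insertWhen : Triple → Triple → Record → State → State
  insertWhen (B , x , y) t w s = if M s B x y then insert t w s else s

  insertWhen-⊑ : ∀ b t w → Extensive (insertWhen b t w)
  insertWhen-⊑ (B , x , y) t w {s} with M s B x y
  ... | true  = insert-⊑ t w
  ... | false = ⊑-refl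

  insertWhen-marks : ∀ b t w s → Marked s b → Marked (insertWhen b t w s) t
  insertWhen-marks b t w s m rewrite m = insert-marks t w s

  -- A premise marked too late to be seen by its own loop iteration is found in the queue.
  join-covers : ∀ {X : Set} {xs : List X} (b t : X → Triple) (w : X → Record) →
                ∀ {x} → x ∈ xs → ∀ s {s′} →
                forEach xs (λ x → insertWhen (b x) (t x) (w x)) s ⊑ s′ →
                Marked s′ (b x) → Marked s′ (t x) ⊎ b x ∈ Q s′
  join-covers b t w {x} x∈ s le m
    with s₁ , le₁ ← forEach-visits (λ {x} _ → insertWhen-⊑ (b x) (t x) (w x)) x∈ s
    with fresh (⊑-trans (insertWhen-⊑ (b x) (t x) (w x) {s₁}) (⊑-trans le₁ le)) (b x) m
  ... | inj₁ m₁ = inj₁ (marked (⊑-trans le₁ le) _ (insertWhen-marks (b x) (t x) (w x) s₁ m₁))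
  ... | inj₂ q  = inj₂ q

  -- Processing one dequeued triple

  leftJoin-⊑ : ∀ t A B C → Extensive (leftJoin t A B C)
  leftJoin-⊑ (X , i , j) A B C with X Fin.≟ B
  ... | no  _ = ⊑-refl
  ... | yes _ = forEach-⊑ {xs = allFin order} λ {k} _ → insertWhen-⊑ (C , j , k) (A , i , k) _

  rightJoin-⊑ : ∀ t A B C → Extensive (rightJoin t A B C)
  rightJoin-⊑ (X , i , j) A B C with X Fin.≟ C
  ... | no  _ = ⊑-refl
  ... | yes _ = forEach-⊑ {xs = allFin order} λ {h} _ → insertWhen-⊑ (B , h , i) (A , h , j) _

  -- Leaving `s′` arbitrary makes this usable at the end of the iteration, after the right join and
  -- the remaining productions have run.
  leftJoin-covers : ∀ A B C i j k s {s′} → leftJoin (B , i , j) A B C s ⊑ s′ →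
                    Marked s′ (C , j , k) → Marked s′ (A , i , k) ⊎ (C , j , k) ∈ Q s′
  leftJoin-covers A B C i j k s with B Fin.≟ B
  ... | no ≢  = contradiction refl ≢
  ... | yes _ = join-covers (λ k → C , j , k) (λ k → A , i , k) (λ _ → bin B C j) (∈-allFin k) s

  rightJoin-covers : ∀ A B C h i j s {s′} → rightJoin (C , i , j) A B C s ⊑ s′ →
                     Marked s′ (B , h , i) → Marked s′ (A , h , j) ⊎ (B , h , i) ∈ Q s′
  rightJoin-covers A B C h i j s with C Fin.≟ C
  ... | no ≢  = contradiction refl ≢
  ... | yes _ = join-covers (λ h → B , h , i) (λ h → A , h , j) (λ _ → bin B C i) (∈-allFin h) s

  processBody-⊑ : ∀ t {p} → p ∈ P → Extensive (processBody t p)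
  processBody-⊑ t p with All.lookup cnf p
  ... | binary {A} {B} {C} = ⊑-trans (leftJoin-⊑ t A B C) (rightJoin-⊑ t A B C)
  ... | terminal           = ⊑-refl
  ... | empty              = ⊑-refl

  process-⊑ : ∀ t → Extensive (process t)
  process-⊑ t = forEach-⊑ (processBody-⊑ t)

  process-coversˡ : ∀ {A B C i j k} → (A , inj₁ B ∷ inj₁ C ∷ []) ∈ P → ∀ s →
                    let s′ = process (B , i , j) s in
                    Marked s′ (C , j , k) → Marked s′ (A , i , k) ⊎ (C , j , k) ∈ Q s′
  process-coversˡ {A} {B} {C} {i} {j} {k} p s
    with s₁ , le ← forEach-visits (processBody-⊑ (B , i , j)) p s
    = leftJoin-covers A B C i j k s₁ (⊑-trans (rightJoin-⊑ (B , i , j) A B C) le)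

  process-coversʳ : ∀ {A B C h i j} → (A , inj₁ B ∷ inj₁ C ∷ []) ∈ P → ∀ s →
                    let s′ = process (C , i , j) s in
                    Marked s′ (B , h , i) → Marked s′ (A , h , j) ⊎ (B , h , i) ∈ Q s′
  process-coversʳ {A} {B} {C} {h} {i} {j} p s
    with s₁ , le ← forEach-visits (processBody-⊑ (C , i , j)) p s
    = rightJoin-covers A B C h i j _ le

  -- The queue alternatives in `binaries` make it hold when the main loop starts, where every mark
  -- is queued, and they vanish once the queue is empty.
  record Complete (s : State) : Set where
    field
      terminals : ∀ {A u v} e → (A , inj₂ (label u v e) ∷ []) ∈ P → Marked s (A , u , v)
      epsilons  : (S , []) ∈ P → ∀ u → Marked s (S , u , u)
      binaries  : ∀ {A B C i j k} → (A , inj₁ B ∷ inj₁ C ∷ []) ∈ P →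
                  Marked s (B , i , j) → Marked s (C , j , k) →
                  Marked s (A , i , k) ⊎ (B , i , j) ∈ Q s ⊎ (C , j , k) ∈ Q s

  open Complete

  ∈-remove : ∀ {X : Set} (xs : List X) {ys x y} → y ∈ xs ++ x ∷ ys → y ≡ x ⊎ y ∈ xs ++ ys
  ∈-remove xs y∈ with ∈-++⁻ xs y∈
  ... | inj₁ l           = inj₂ (∈-++⁺ˡ l)
  ... | inj₂ (here refl) = inj₁ refl
  ... | inj₂ (there r)   = inj₂ (∈-++⁺ʳ xs r)

  ⟶-complete : ∀ {s s′} → s ⟶ s′ → Complete s → Complete s′
  ⟶-complete (dequeue {m} {w} ts t ts′) c = record
    { terminals = λ e p → marked le _ (terminals c e p)
    ; epsilons  = λ p u → marked le _ (epsilons c p u)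
    ; binaries  = joins
    }
    where
    s₀ = ⟨ m , w , ts ++ ts′ ⟩
    s₁ = process t s₀
    le : s₀ ⊑ s₁
    le = process-⊑ t
    joins : ∀ {A B C i j k} → (A , inj₁ B ∷ inj₁ C ∷ []) ∈ P →
            Marked s₁ (B , i , j) → Marked s₁ (C , j , k) →
            Marked s₁ (A , i , k) ⊎ (B , i , j) ∈ Q s₁ ⊎ (C , j , k) ∈ Q s₁
    joins p b c′ with fresh le _ b | fresh le _ c′
    -- A premise marked during this iteration is still queued, so the old invariant is needed only
    -- when both premises are old.
    ... | inj₂ q  | _       = inj₂ (inj₁ q)
    ... | inj₁ _  | inj₂ q  = inj₂ (inj₂ q)
    ... | inj₁ b₀ | inj₁ c₀ with binaries c p b₀ c₀
    ...   | inj₁ a = inj₁ (marked le _ a)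
    ...   | inj₂ (inj₁ q) with ∈-remove ts q
    -- The queued premise was `t` itself and has left the queue, but `process` has just joined it
    -- with its partner.
    ...     | inj₁ refl = Sum.map₂ inj₂ (process-coversˡ p s₀ c′)
    ...     | inj₂ q₀   = inj₂ (inj₁ (queued le q₀))
    joins p b c′ | inj₁ b₀ | inj₁ c₀ | inj₂ (inj₂ q) with ∈-remove ts q
    ...     | inj₁ refl = Sum.map₂ inj₁ (process-coversʳ p s₀ b)
    ...     | inj₂ q₀   = inj₂ (inj₂ (queued le q₀))

  ⟶*-complete : ∀ {s s′} → s ⟶* s′ → Complete s → Complete s′
  ⟶*-complete ε              c = c
  ⟶*-complete (step ◅ steps) c = ⟶*-complete steps (⟶-complete step c)

  start-complete : Complete (epsilonPhase (terminalPhase initial))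
  start-complete = record
    { terminals = λ e p → marked epsilonPhase-⊑ _ (terminalPhase-marks e p initial)
    ; epsilons  = λ p u → epsilonPhase-marks p u _
    ; binaries  = λ _ b _ → inj₂ (inj₁ (marked⇒queued _ b))
    }
    where
    marked⇒queued : ∀ t → Marked (epsilonPhase (terminalPhase initial)) t →
                   t ∈ Q (epsilonPhase (terminalPhase initial))
    marked⇒queued t m
      with fresh (⊑-trans (forEach-⊑ terminalBody-⊑) (epsilonPhase-⊑ {terminalPhase initial})) t m
    -- The other alternative is impossible, since `initial` marks nothing.
    ... | inj₂ q = q

  final-complete : ∀ {s} → Final s → ∀ {A u v} → Reach A u v → Marked s (A , u , v)
  final-complete {s} (steps , done) = go
    where
    c : Complete s
    c = ⟶*-complete steps start-complete
    go : ∀ {A u v} → Reach A u v → Marked s (A , u , v)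
    go (term p e refl) = terminals c e p
    go (eps p)         = epsilons c p _
    go (bin p r r′) with binaries c p (go r) (go r′)
    ... | inj₁ a        = a
    ... | inj₂ (inj₁ q) with () ← subst (_ ∈_) done q
    ... | inj₂ (inj₂ q) with () ← subst (_ ∈_) done q

theorem2p2 : ∀ {σ : ℕ} (G : LabeledDigraph σ) (𝒢 : CFG σ) → CFG.CNF 𝒢 →
    let open SatIndexBuild G 𝒢 in
    ∀ (s : State) → Final s →
    ∀ (A : CFG.N 𝒢) (u v : LabeledDigraph.V G) → (M s A u v ≡ true) ⇔ 𝓡 G 𝒢 A u v
theorem2p2 G 𝒢 cnf s final A u v = mk⇔
  (λ m → Reach⇒𝓡 (proj₁ (final-sound final) (A , u , v) m))
  (λ r → final-complete final (𝓡⇒Reach cnf r))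
  where
  open Reachability G 𝒢
  open Correctness G 𝒢 cnf
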